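{- Let $\lambda$ be a nonzero real number and let $x,y\in\mathbb{R}$. For every integer $n\ge 0$, $$C_{n,\lambda}(x,y)=\frac{1}{2}\left(\sum_{l=0}^{n}\binom{n}{l}(1)_{n-l,\lambda}\mathcal{E}_{l,\lambda}^{(c)}(x,y)+\mathcal{E}_{n,\lambda}^{(c)}(x,y)\right)$$ and $$S_{n,\lambda}(x,y)=\frac{1}{2}\left(\sum_{l=0}^{n}\binom{n}{l}(1)_{n-l,\lambda}\mathcal{E}_{l,\lambda}^{(s)}(x,y)+\mathcal{E}_{n,\lambda}^{(s)}(x,y)\right).$$
   Context: All generating functions are power series in $t$ around $t=0$. For nonzero $\lambda\in\mathbb{R}$ and complex $z$, the degenerate exponential is $e_\lambda^{z}(t)=(1+\lambda t)^{z/\lambda}$, and $e_\lambda(t)=e_\lambda^1(t)$. The degenerate cosine and sine functions are $\cos_\lambda^{(y)}(t)=\frac{e_\lambda^{iy}(t)+e_\lambda^{ -iy}(t)}{2}=\cos\left(\frac{y}{\lambda}\log(1+\lambda t)\right)$ and $\sin_\lambda^{(y)}(t)=\frac{e_\lambda^{iy}(t)-e_\lambda^{ -iy}(t)}{2i}=\sin\left(\frac{y}{\lambda}\log(1+\lambda t)\right)$, with $i=\sqrt{ -1}$. The degenerate cosine-Euler and sine-Euler polynomials are defined by $\frac{2}{e_\lambda(t)+1}e_\lambda^{x}(t)\cos_\lambda^{(y)}(t)=\sum_{n=0}^{\infty}\mathcal{E}_{n,\lambda}^{(c)}(x,y)\frac{t^n}{n!}$ and $\frac{2}{e_\lambda(t)+1}e_\lambda^{x}(t)\sin_\lambda^{(y)}(t)=\sum_{n=0}^{\infty}\mathcal{E}_{n,\lambda}^{(s)}(x,y)\frac{t^n}{n!}$.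 The degenerate cosine-polynomials and sine-polynomials are defined by $e_\lambda^{x}(t)\cos_\lambda^{(y)}(t)=\sum_{n=0}^{\infty}C_{n,\lambda}(x,y)\frac{t^n}{n!}$ and $e_\lambda^{x}(t)\sin_\lambda^{(y)}(t)=\sum_{n=0}^{\infty}S_{n,\lambda}(x,y)\frac{t^n}{n!}$. The generalized falling factorials are $(x)_{0,\lambda}=1$, $(x)_{n,\lambda}=x(x-\lambda)(x-2\lambda)\cdots(x-(n-1)\lambda)$ for $n\ge1$. -}

module Defs where

open import Level using (Level; _⊔_) renaming (suc to lsuc)
open import Algebra.Bundles using (AbelianGroup; CommutativeRing; Semiring)
open import Algebra.Apartness.Bundles using (HeytingField; HeytingCommutativeRing)
open import Data.Fin.Base using (toℕ)
open import Data.Nat.Base as ℕ using (ℕ; zero; suc; _∸_; NonZero; _!)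
open import Data.Nat.Properties using (_!≢0)
open import Data.Product.Base using (_×_; _,_; proj₁; proj₂; ∃-syntax)
open import Data.Sum.Base using (_⊎_)
open import Data.Vec.Base using (Vec; []; _∷_; head; lookup)
open import Relation.Binary.Core using (Rel)
open import Relation.Binary.Structures using (IsStrictPartialOrder)
import Algebra.Definitions
import Algebra.Consequences.Setoid
import Algebra.Construct.DirectProduct
import Algebra.Definitions.RawSemiring
import Algebra.Properties.CommutativeSemigroup
import Algebra.Properties.Ring
import Algebra.Solver.Ring.NaturalCoefficients.Default

private variable
  c ℓ₁ ℓ₂ ℓ₃ : Level

-- The standard library has no type of real numbers.  They are axiomatised here
-- as a Cauchy-complete Archimedean ordered field.  Classically these axioms
-- determine ℝ up to isomorphism, with x # y equivalent to x ≠ y;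
-- constructively they hold of the Bishop reals.
record RealNumbers c ℓ₁ ℓ₂ ℓ₃ : Set (lsuc (c ⊔ ℓ₁ ⊔ ℓ₂ ⊔ ℓ₃)) where
  infix 4 _<_
  field
    heytingField : HeytingField c ℓ₁ ℓ₂

  open HeytingField heytingField public renaming (Carrier to ℝ)

  commutativeRing : CommutativeRing c ℓ₁
  commutativeRing = HeytingCommutativeRing.commutativeRing heytingCommutativeRing

  open CommutativeRing commutativeRing public using (semiring)
  open Algebra.Definitions.RawSemiring (Semiring.rawSemiring semiring) public
    using () renaming (_×_ to _•_)

  field
    _<_                  : Rel ℝ ℓ₃
    isStrictPartialOrder : IsStrictPartialOrder _≈_ _<_
    <⇒#                  : ∀ {x y} → x < y → x # y
    #⇒<⊎>                : ∀ {x y} → x # y → x < y ⊎ y < x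
    0<1                  : 0# < 1#
    +-monoʳ-<            : ∀ z {x y} → x < y → z + x < z + y
    *-pos                : ∀ {x y} → 0# < x → 0# < y → 0# < x * y
    archimedean          : ∀ x → ∃[ n ] x < n • 1#

  IsCauchy : (ℕ → ℝ) → Set (c ⊔ ℓ₃)
  IsCauchy u = ∀ ε → 0# < ε →
    ∃[ N ] (∀ m n → N ℕ.≤ m → N ℕ.≤ n → u m - u n < ε)

  _ConvergesTo_ : (ℕ → ℝ) → ℝ → Set (c ⊔ ℓ₃)
  u ConvergesTo l = ∀ ε → 0# < ε →
    ∃[ N ] (∀ n → N ℕ.≤ n → u n - l < ε × l - u n < ε)

  field
    complete : ∀ u → IsCauchy u → ∃[ l ] u ConvergesTo l

module Units (R : CommutativeRing c ℓ₁) where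
  open CommutativeRing R
  open Algebra.Definitions _≈_ using (Invertible)

  record Unit : Set (c ⊔ ℓ₁) where
    constructor unit
    field
      value      : Carrier
      invertible : Invertible 1# _*_ value

    inverse : Carrier
    inverse = proj₁ invertible

  open Unit public

  infixl 7 _/_ _*ᵘ_

  _/_ : Carrier → Unit → Carrier
  x / u = x * inverse u

  _*ᵘ_ : Unit → Unit → Unit
  unit a (a′ , a′a , aa′) *ᵘ unit b (b′ , b′b , bb′) =
    unit (a * b) (a′ * b′ , trans (*-comm (a′ * b′) (a * b)) p , p)
    where
    open Algebra.Properties.CommutativeSemigroup *-commutativeSemigroup using (interchange)
    p : (a * b) * (a′ * b′) ≈ 1#
    p = trans (interchange a b a′ b′) (trans (*-cong aa′ bb′) (*-identityˡ 1#))

-- Formal power series, f n being the coefficient of tⁿ.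
module PowerSeries (R : CommutativeRing c ℓ₁) where
  open CommutativeRing R
  open Algebra.Definitions _≈_ using (Invertible)
  open Algebra.Definitions.RawSemiring (Semiring.rawSemiring semiring)
    using (_^_; sum) renaming (_×_ to _•_)

  Series : Set c
  Series = ℕ → Carrier

  infixl 6 _+ˢ_ _-ˢ_
  infixl 7 _*ˢ_

  constant : Carrier → Series
  constant a zero    = a
  constant a (suc _) = 0#

  _+ˢ_ _-ˢ_ _*ˢ_ : Series → Series → Series
  (f +ˢ g) n = f n + g n
  (f -ˢ g) n = f n - g n
  (f *ˢ g) n = sum {suc n} λ k → f (toℕ k) * g (n ∸ toℕ k)

  -- f (a t)
  rescale : Carrier → Series → Series
  rescale a f n = a ^ n * f n

  -- The coefficients bₙ , … , b₀ of 1 / f, in this order, obtained from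
  -- f₀ b₀ = 1 and f₀ bₘ₊₁ = - (f₁ bₘ + f₂ bₘ₋₁ + … + fₘ₊₁ b₀).
  recipPrefix : (f : Series) → Invertible 1# _*_ (f 0) → ∀ n → Vec Carrier (suc n)
  recipPrefix f (f₀⁻¹ , _) zero    = f₀⁻¹ ∷ []
  recipPrefix f inv@(f₀⁻¹ , _) (suc n) = next ∷ previous
    where
    previous : Vec Carrier (suc n)
    previous = recipPrefix f inv n
    next : Carrier
    next = - (f₀⁻¹ * sum λ i → f (suc (toℕ i)) * lookup previous i)

  recip : (f : Series) → Invertible 1# _*_ (f 0) → Series
  recip f inv n = head (recipPrefix f inv n)

  -- The sequence a with f = ∑ aₙ tⁿ / n! .
  egfCoefficients : Series → ℕ → Carrier
  egfCoefficients f n = (n !) • f n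

module FallingFactorial (R : CommutativeRing c ℓ₁) where
  open CommutativeRing R
  open Algebra.Definitions.RawSemiring (Semiring.rawSemiring semiring) using () renaming (_×_ to _•_)

  infix 8 ⟨_⟩[_,_]

  -- (x)ₙ,μ = x (x - μ) (x - 2μ) ⋯ (x - (n-1)μ)
  ⟨_⟩[_,_] : Carrier → ℕ → Carrier → Carrier
  ⟨ x ⟩[ zero  , μ ] = 1#
  ⟨ x ⟩[ suc n , μ ] = ⟨ x ⟩[ n , μ ] * (x - n • μ)

module Complex (ℛ : RealNumbers c ℓ₁ ℓ₂ ℓ₃) where
  open RealNumbers ℛ
  open CommutativeRing commutativeRing using (ring; commutativeSemiring; +-abelianGroup)
  open Algebra.Properties.Ring ring using (-1*x≈-x; -0#≈0#; -‿involutive)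

  ℂ : Set _
  ℂ = ℝ × ℝ

  ℂ-+-abelianGroup : AbelianGroup _ _
  ℂ-+-abelianGroup =
    Algebra.Construct.DirectProduct.abelianGroup +-abelianGroup +-abelianGroup

  x-0≈x : ∀ x → x - 0# ≈ x
  x-0≈x x = trans (+-congˡ -0#≈0#) (+-identityʳ x)

  ℂ-commutativeRing : CommutativeRing _ _
  ℂ-commutativeRing = record
    { Carrier = ℂ
    ; _≈_ = _≈ℂ_
    ; _+_ = λ (a , b) (a′ , b′) → a + a′ , b + b′
    ; _*_ = _*ℂ_
    ; -_  = λ (a , b) → - a , - b
    ; 0#  = 0# , 0#
    ; 1#  = 1# , 0#
    ; isCommutativeRing = record
      { isRing = record
        { +-isAbelianGroup = ℂ+.isAbelianGroup
        ; *-cong = λ (p , q) (p′ , q′) →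
            +-cong (*-cong p p′) (-‿cong (*-cong q q′)) ,
            +-cong (*-cong p q′) (*-cong q p′)
        ; *-assoc = λ (a , b) (d , e) (g , h) → assocRe a b d e g h , assocIm a b d e g h
        ; *-identity = comm∧idˡ⇒id comm λ (a , b) → idRe a b , idIm a b
        ; distrib = comm∧distrˡ⇒distr ℂ+.∙-cong comm
            λ (a , b) (d , e) (g , h) → distRe a b d e g h , distIm a b d e g h
        }
      ; *-comm = comm
      }
    }
    where
    module ℂ+ = AbelianGroup ℂ-+-abelianGroup
    open Algebra.Consequences.Setoid ℂ+.setoid using (comm∧idˡ⇒id; comm∧distrˡ⇒distr)
    open Algebra.Solver.Ring.NaturalCoefficients.Default commutativeSemiring
      using (solve; _:+_; _:*_; _:=_)

    infix 4 _≈ℂ_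
    _≈ℂ_ : Rel ℂ _
    (a , b) ≈ℂ (a′ , b′) = a ≈ a′ × b ≈ b′

    infixl 7 _*ℂ_
    _*ℂ_ : ℂ → ℂ → ℂ
    (a , b) *ℂ (a′ , b′) = a * a′ - b * b′ , a * b′ + b * a′

    comm : ∀ z w → (z *ℂ w) ≈ℂ (w *ℂ z)
    comm (a , b) (d , e) =
      +-cong (*-comm a d) (-‿cong (*-comm b e)) ,
      trans (+-cong (*-comm a e) (*-comm b d)) (+-comm (e * a) (d * b))

    idRe : ∀ a b → 1# * a - 0# * b ≈ a
    idRe a b = trans (+-cong (*-identityˡ a) (-‿cong (zeroˡ b))) (x-0≈x a)
    idIm : ∀ a b → 1# * b + 0# * a ≈ b
    idIm a b = trans (+-cong (*-identityˡ b) (zeroˡ a)) (+-identityʳ b)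

    -- The solver is for semirings, so s = -1 is passed to it as a variable.
    s : ℝ
    s = - 1#
    sub : ∀ x y → x - y ≈ x + s * y
    sub x y = +-congˡ (sym (-1*x≈-x y))

    distRe : ∀ a b d e g h → a * (d + g) - b * (e + h)
                            ≈ (a * d - b * e) + (a * g - b * h)
    distRe a b d e g h = trans (sub _ _) (trans
      (solve 7 (λ s a b d e g h →
         a :* (d :+ g) :+ s :* (b :* (e :+ h)) :=
         (a :* d :+ s :* (b :* e)) :+ (a :* g :+ s :* (b :* h))) refl s a b d e g h)
      (sym (+-cong (sub _ _) (sub _ _))))
    distIm : ∀ a b d e g h → a * (e + h) + b * (d + g)
                            ≈ (a * e + b * d) + (a * h + b * g)
    distIm = solve 6 (λ a b d e g h →
         a :* (e :+ h) :+ b :* (d :+ g) :=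
         (a :* e :+ b :* d) :+ (a :* h :+ b :* g)) refl
    assocRe : ∀ a b d e g h → (a * d - b * e) * g - (a * e + b * d) * h
                            ≈ a * (d * g - e * h) - b * (d * h + e * g)
    assocRe a b d e g h = trans (trans (sub _ _) (+-congʳ (*-congʳ (sub _ _)))) (trans
      (solve 7 (λ s a b d e g h →
         (a :* d :+ s :* (b :* e)) :* g :+ s :* ((a :* e :+ b :* d) :* h) :=
         a :* (d :* g :+ s :* (e :* h)) :+ s :* (b :* (d :* h :+ e :* g))) refl s a b d e g h)
      (sym (trans (sub _ _) (+-congʳ (*-congˡ (sub _ _))))))
    assocIm : ∀ a b d e g h → (a * d - b * e) * h + (a * e + b * d) * g
                            ≈ a * (d * h + e * g) + b * (d * g - e * h)
    assocIm a b d e g h = trans (+-congʳ (*-congʳ (sub _ _))) (trans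
      (solve 7 (λ s a b d e g h →
         (a :* d :+ s :* (b :* e)) :* h :+ (a :* e :+ b :* d) :* g :=
         a :* (d :* h :+ e :* g) :+ b :* (d :* g :+ s :* (e :* h))) refl s a b d e g h)
      (sym (+-congˡ (*-congˡ (sub _ _)))))

  module ℂ = CommutativeRing ℂ-commutativeRing
  open Units ℂ-commutativeRing
  open Algebra.Definitions.RawSemiring (Semiring.rawSemiring ℂ.semiring) public
    using () renaming (sum to ∑; _×_ to _•ℂ_)

  ofReal : ℝ → ℂ
  ofReal r = r , 0#

  𝕚 : ℂ
  𝕚 = 0# , 1#

  0<suc• : ∀ n → 0# < suc n • 1#
  0<suc• zero    = <-respʳ-≈ (sym (+-identityʳ 1#)) 0<1
    where open IsStrictPartialOrder isStrictPartialOrder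
  0<suc• (suc n) = <-trans 0<1 (<-respˡ-≈ (+-identityʳ 1#) (+-monoʳ-< 1# (0<suc• n)))
    where open IsStrictPartialOrder isStrictPartialOrder renaming (trans to <-trans)

  realUnit : ∀ r → r # 0# → Unit
  realUnit r r#0 = unit (ofReal r) (ofReal s , ℂ.trans (ℂ.*-comm (ofReal s) (ofReal r)) p , p)
    where
    s : ℝ
    s = proj₁ (#⇒invertible r#0)
    re : r * s - 0# * 0# ≈ (r - 0#) * s
    re = trans (+-congˡ (-‿cong (zeroˡ 0#))) (trans (x-0≈x (r * s)) (*-congʳ (sym (x-0≈x r))))
    im : r * 0# + 0# * s ≈ 0#
    im = trans (+-cong (zeroʳ r) (zeroˡ s)) (+-identityʳ 0#)
    p : ofReal r ℂ.* ofReal s ℂ.≈ ℂ.1#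
    p = trans re (proj₂ (proj₂ (#⇒invertible r#0))) , im

  natUnit : ∀ n → .{{NonZero n}} → Unit
  natUnit n@(suc m) = realUnit (n • 1#) (#-sym (<⇒# (0<suc• m)))

  𝕚-unit : Unit
  𝕚-unit = unit 𝕚 (ℂ.- 𝕚 , ℂ.trans (ℂ.*-comm (ℂ.- 𝕚) 𝕚) p , p)
    where
    p : 𝕚 ℂ.* (ℂ.- 𝕚) ℂ.≈ ℂ.1#
    p = trans (+-cong (zeroˡ (- 0#)) (-‿cong (*-identityˡ (- 1#))))
              (trans (+-identityˡ (- (- 1#))) (-‿involutive 1#))
      , trans (+-cong (zeroˡ (- 1#)) (*-identityˡ (- 0#)))
              (trans (+-identityˡ (- 0#)) -0#≈0#)

module Degenerate (ℛ : RealNumbers c ℓ₁ ℓ₂ ℓ₃) (λ₀ : RealNumbers.ℝ ℛ)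
                  (λ₀#0 : RealNumbers._#_ ℛ λ₀ (RealNumbers.0# ℛ)) where
  open RealNumbers ℛ
  open Complex ℛ
  open Units ℂ-commutativeRing
  open PowerSeries ℂ-commutativeRing
  open FallingFactorial ℂ-commutativeRing
  open Algebra.Definitions ℂ._≈_ using (Invertible)

  2ᵘ 2𝕚ᵘ λᵘ : Unit
  2ᵘ  = natUnit 2
  2𝕚ᵘ = 2ᵘ *ᵘ 𝕚-unit
  λᵘ  = realUnit λ₀ λ₀#0

  -- (1 + t)^α = ∑ α(α-1)⋯(α-n+1) / n! tⁿ
  binomialSeries : ℂ → Series
  binomialSeries α n = ⟨ α ⟩[ n , ℂ.1# ] / natUnit (n !) {{n !≢0}}

  -- e_λ^z(t) = (1 + λt)^(z/λ)
  eᵖ : ℂ → Series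
  eᵖ z = rescale (ofReal λ₀) (binomialSeries (z / λᵘ))

  e : Series
  e = eᵖ ℂ.1#

  cosˢ sinˢ : ℝ → Series
  cosˢ y n = (eᵖ (𝕚 ℂ.* ofReal y) +ˢ eᵖ (ℂ.- (𝕚 ℂ.* ofReal y))) n / 2ᵘ
  sinˢ y n = (eᵖ (𝕚 ℂ.* ofReal y) -ˢ eᵖ (ℂ.- (𝕚 ℂ.* ofReal y))) n / 2𝕚ᵘ

  e+1 : Series
  e+1 = e +ˢ constant ℂ.1#

  e+1-invertible : Invertible ℂ.1# ℂ._*_ (e+1 0)
  e+1-invertible =
    inverse 2ᵘ ,
    ℂ.trans (ℂ.*-congˡ e+1≈2) (proj₁ (proj₂ (invertible 2ᵘ))) ,
    ℂ.trans (ℂ.*-congʳ e+1≈2) (proj₂ (proj₂ (invertible 2ᵘ)))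
    where
    1ᵘ : Unit
    1ᵘ = natUnit 1
    1≈1ᵘ : ℂ.1# ℂ.≈ value 1ᵘ
    1≈1ᵘ = sym (+-identityʳ 1#) , refl
    1/1≈1 : ℂ.1# / 1ᵘ ℂ.≈ ℂ.1#
    1/1≈1 = ℂ.trans (ℂ.*-congʳ 1≈1ᵘ) (proj₂ (proj₂ (invertible 1ᵘ)))
    e₀≈1 : e 0 ℂ.≈ ℂ.1#
    e₀≈1 = ℂ.trans (ℂ.*-identityˡ (ℂ.1# / 1ᵘ)) 1/1≈1
    e+1≈2 : e+1 0 ℂ.≈ value 2ᵘ
    e+1≈2 = ℂ.trans (ℂ.+-congʳ e₀≈1) (+-congˡ (sym (+-identityʳ 1#)) , +-identityʳ 0#)

  -- 2 / (e_λ(t) + 1)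
  eulerKernel : Series
  eulerKernel = constant (value 2ᵘ) *ˢ recip e+1 e+1-invertible

  𝓔ᶜ 𝓔ˢ 𝒞 𝒮 : ℕ → ℝ → ℝ → ℂ
  𝓔ᶜ n x y = egfCoefficients (eulerKernel *ˢ eᵖ (ofReal x) *ˢ cosˢ y) n
  𝓔ˢ n x y = egfCoefficients (eulerKernel *ˢ eᵖ (ofReal x) *ˢ sinˢ y) n
  𝒞 n x y = egfCoefficients (eᵖ (ofReal x) *ˢ cosˢ y) n
  𝒮 n x y = egfCoefficients (eᵖ (ofReal x) *ˢ sinˢ y) n

-- Write K = 2 / (e_λ + 1) and F = K e_λ^x T, where T is the cosine or the sine
-- series, so that G = e_λ^x T satisfies (e_λ + 1) F = 2 G.  The coefficient of
-- tⁿ/n! in e_λ is (1)ₙ,λ, because (1 + λt)^(1/λ) has n-th coefficient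
-- λⁿ (1/λ)ₙ,₁ / n! and λⁿ (1/λ)ₙ,₁ = (1)ₙ,λ by homogeneity.  Comparing coefficients in
-- e_λ F + F = 2 G, with the product on the left a binomial convolution, gives
-- both identities.
module Submission where

open import Defs
open import Algebra.Bundles using (CommutativeRing; CommutativeSemigroup; Semiring)
import Algebra.Definitions.RawSemiring
import Algebra.Properties.CommutativeMonoid.Mult
import Algebra.Properties.CommutativeSemigroup
import Algebra.Properties.Ring
import Algebra.Properties.Semiring.Mult
import Algebra.Properties.Semiring.Sum
open import Data.Fin.Base using (Fin; zero; suc; toℕ)
open import Data.Fin.Properties using (toℕ≤pred[n])
open import Data.Nat.Base as ℕ using (ℕ; zero; suc; _∸_; NonZero; _!)
open import Data.Nat.Combinatorics using (_C_; nCk≡n!/k![n-k]!; k![n∸k]!∣n!)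
open import Data.Nat.DivMod using (m/n*n≡m)
open import Data.Nat.Properties using (_!≢0; _!*_!≢0)
open import Data.Product.Base using (_×_; _,_; proj₂)
open import Data.Vec.Base using (lookup)
open import Function.Base using (_∘_)
open import Level using (Level)
open import Relation.Binary.PropositionalEquality as ≡ using (_≡_)
import Relation.Binary.Reasoning.Setoid

private variable
  c ℓ ℓ₁ ℓ₂ ℓ₃ : Level

-- The quotient formula for `n C k` is an exact division, since `k ! * (n ∸ k) !` divides `n !`. The
-- product form can be applied to natural multiples of ring elements.
nCk*k![n∸k]!≡n! : ∀ {n k} → k ℕ.≤ n → (n C k) ℕ.* (k ! ℕ.* (n ∸ k) !) ≡ n !
nCk*k![n∸k]!≡n! {n} {k} k≤n = ≡.trans
  (≡.cong (ℕ._* (k ! ℕ.* (n ∸ k) !)) (nCk≡n!/k![n-k]! k≤n))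
  (m/n*n≡m (k![n∸k]!∣n! k≤n))
  where instance
    _ = k !* (n ∸ k) !≢0

module PowerSeriesProperties (R : CommutativeRing c ℓ) where
  open CommutativeRing R hiding (zero)
  open PowerSeries R
  open Algebra.Definitions.RawSemiring (Semiring.rawSemiring semiring)
    using (sum) renaming (_×_ to _•_)
  open Algebra.Properties.CommutativeMonoid.Mult +-commutativeMonoid using (×-distrib-+)
  open Algebra.Properties.CommutativeSemigroup +-commutativeSemigroup
    using () renaming (interchange to +-interchange)
  open Algebra.Properties.Ring ring using (-‿distribʳ-*)
  open Algebra.Properties.Semiring.Mult semiring
  open Algebra.Properties.Semiring.Sum semiring using (sum-cong-≋)
  open Relation.Binary.Reasoning.Setoid setoid

  -- The convolution product of power series

  infix 4 _≈ˢ_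
  _≈ˢ_ : Series → Series → Set ℓ
  f ≈ˢ g = ∀ n → f n ≈ g n

  *ˢ-cong : ∀ {f f′ g g′} → f ≈ˢ f′ → g ≈ˢ g′ → f *ˢ g ≈ˢ f′ *ˢ g′
  *ˢ-cong p q n = sum-cong-≋ {suc n} λ k → *-cong (p (toℕ k)) (q (n ∸ toℕ k))

  -- By definition (f *ˢ g) (suc n) = f 0 * g (suc n) + ((f ∘ suc) *ˢ g) n;
  -- the inductions below unfold the product in this way.
  *ˢ-distribʳ : ∀ f g h → (f +ˢ g) *ˢ h ≈ˢ f *ˢ h +ˢ g *ˢ h
  *ˢ-distribʳ f g h zero    = begin
    (f 0 + g 0) * h 0 + 0#                ≈⟨ +-cong (distribʳ _ _ _) (sym (+-identityʳ 0#)) ⟩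
    (f 0 * h 0 + g 0 * h 0) + (0# + 0#)   ≈⟨ +-interchange _ _ _ _ ⟩
    (f *ˢ h +ˢ g *ˢ h) 0                  ∎
  *ˢ-distribʳ f g h (suc n) = trans
    (+-cong (distribʳ _ _ _) (*ˢ-distribʳ (f ∘ suc) (g ∘ suc) h n))
    (+-interchange _ _ _ _)

  scale-*ˢ : ∀ a f g n → ((λ k → a * f k) *ˢ g) n ≈ a * (f *ˢ g) n
  scale-*ˢ a f g zero    = begin
    a * f 0 * g 0 + 0#     ≈⟨ +-cong (*-assoc _ _ _) (sym (zeroʳ a)) ⟩
    a * (f 0 * g 0) + a * 0# ≈⟨ distribˡ _ _ _ ⟨
    a * (f 0 * g 0 + 0#)   ∎
  scale-*ˢ a f g (suc n) = trans
    (+-cong (*-assoc _ _ _) (scale-*ˢ a (f ∘ suc) g n))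
    (sym (distribˡ _ _ _))

  -- The tail of `f *ˢ g` is `f 0` times the tail of `g` plus `(f ∘ suc) *ˢ g`. Distributivity and
  -- scaling split the product with `h` accordingly, and the induction hypothesis at `f ∘ suc`
  -- handles the second summand.
  *ˢ-assoc : ∀ f g h → (f *ˢ g) *ˢ h ≈ˢ f *ˢ (g *ˢ h)
  *ˢ-assoc f g h zero    = +-congʳ (begin
    (f 0 * g 0 + 0#) * h 0   ≈⟨ *-congʳ (+-identityʳ _) ⟩
    f 0 * g 0 * h 0          ≈⟨ *-assoc _ _ _ ⟩
    f 0 * (g 0 * h 0)        ≈⟨ *-congˡ (+-identityʳ _) ⟨
    f 0 * (g 0 * h 0 + 0#)   ∎)
  *ˢ-assoc f g h (suc n) = begin
    (f 0 * g 0 + 0#) * h (suc n) + (((λ k → f 0 * g (suc k)) +ˢ (f ∘ suc) *ˢ g) *ˢ h) n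
      ≈⟨ +-cong (trans (*-congʳ (+-identityʳ _)) (*-assoc _ _ _))
                (trans (*ˢ-distribʳ (λ k → f 0 * g (suc k)) ((f ∘ suc) *ˢ g) h n)
                       (+-cong (scale-*ˢ (f 0) (g ∘ suc) h n) (*ˢ-assoc (f ∘ suc) g h n))) ⟩
    f 0 * (g 0 * h (suc n)) + (f 0 * ((g ∘ suc) *ˢ h) n + ((f ∘ suc) *ˢ (g *ˢ h)) n)
      ≈⟨ +-assoc _ _ _ ⟨
    f 0 * (g 0 * h (suc n)) + f 0 * ((g ∘ suc) *ˢ h) n + ((f ∘ suc) *ˢ (g *ˢ h)) n
      ≈⟨ +-congʳ (distribˡ _ _ _) ⟨
    (f *ˢ (g *ˢ h)) (suc n) ∎

  -- Splits off the last term of the convolution, whereas the definition splits off the first.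
  -- Commutativity reverses the sum and so needs both ends.
  *ˢ-unfoldʳ : ∀ f g n → (f *ˢ g) (suc n) ≈ (f *ˢ (g ∘ suc)) n + f (suc n) * g 0
  *ˢ-unfoldʳ f g zero    = begin
    f 0 * g 1 + (f 1 * g 0 + 0#)   ≈⟨ +-cong (+-identityʳ _) (sym (+-identityʳ _)) ⟨
    f 0 * g 1 + 0# + f 1 * g 0     ∎
  *ˢ-unfoldʳ f g (suc n) = trans
    (+-congˡ (*ˢ-unfoldʳ (f ∘ suc) g n))
    (sym (+-assoc _ _ _))

  *ˢ-comm : ∀ f g → f *ˢ g ≈ˢ g *ˢ f
  *ˢ-comm f g zero    = +-congʳ (*-comm _ _)
  *ˢ-comm f g (suc n) = begin
    f 0 * g (suc n) + ((f ∘ suc) *ˢ g) n   ≈⟨ +-cong (*-comm _ _) (*ˢ-comm (f ∘ suc) g n) ⟩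
    g (suc n) * f 0 + (g *ˢ (f ∘ suc)) n   ≈⟨ +-comm _ _ ⟩
    (g *ˢ (f ∘ suc)) n + g (suc n) * f 0   ≈⟨ *ˢ-unfoldʳ g f n ⟨
    (g *ˢ f) (suc n)                       ∎

  -- Makes generic rearrangements and setoid reasoning available for whole series.
  *ˢ-commutativeSemigroup : CommutativeSemigroup c ℓ
  *ˢ-commutativeSemigroup = record
    { Carrier = Series
    ; _≈_ = _≈ˢ_
    ; _∙_ = _*ˢ_
    ; isCommutativeSemigroup = record
      { isSemigroup = record
        { isMagma = record
          { isEquivalence = record
            { refl  = λ _ → refl
            ; sym   = λ p n → sym (p n)
            ; trans = λ p q n → trans (p n) (q n)
            }
          ; ∙-cong = λ {f} {f′} {g} {g′} → *ˢ-cong {f} {f′} {g} {g′}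
          }
        ; assoc = *ˢ-assoc
        }
      ; comm = *ˢ-comm
      }
    }

  -- Constant series and reciprocals

  zero-*ˢ : ∀ f n → ((λ _ → 0#) *ˢ f) n ≈ 0#
  zero-*ˢ f zero    = trans (+-identityʳ _) (zeroˡ _)
  zero-*ˢ f (suc n) = trans (+-cong (zeroˡ _) (zero-*ˢ f n)) (+-identityʳ 0#)

  constant-*ˢ : ∀ a f n → (constant a *ˢ f) n ≈ a * f n
  constant-*ˢ a f zero    = +-identityʳ _
  constant-*ˢ a f (suc n) = trans (+-congˡ (zero-*ˢ f n)) (+-identityʳ _)

  -- The prefix lists coefficients in descending order, so position `i` holds degree `n ∸ toℕ i`.
  -- This turns the sum in the recursion for the reciprocal into a convolution.
  lookup-recipPrefix : ∀ f inv n (i : Fin (suc n)) →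
    lookup (recipPrefix f inv n) i ≡ recip f inv (n ∸ toℕ i)
  lookup-recipPrefix f inv zero    zero    = ≡.refl
  lookup-recipPrefix f inv (suc n) zero    = ≡.refl
  lookup-recipPrefix f inv (suc n) (suc i) = lookup-recipPrefix f inv n i

  -- In positive degree the newest coefficient is chosen so that its product with `f 0` is the
  -- negative of the remaining convolution `s`.
  *ˢ-recip : ∀ f inv → f *ˢ recip f inv ≈ˢ constant 1#
  *ˢ-recip f (f₀⁻¹ , _ , f₀f₀⁻¹≈1)      zero    = trans (+-identityʳ _) f₀f₀⁻¹≈1
  *ˢ-recip f inv@(f₀⁻¹ , _ , f₀f₀⁻¹≈1) (suc n) = begin
    f 0 * - (f₀⁻¹ * s) + ((f ∘ suc) *ˢ recip f inv) n  ≈⟨ +-cong cancel same ⟩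
    - s + s                                            ≈⟨ -‿inverseˡ s ⟩
    0#                                                 ∎
    where
    s : Carrier
    s = sum λ i → f (suc (toℕ i)) * lookup (recipPrefix f inv n) i
    cancel : f 0 * - (f₀⁻¹ * s) ≈ - s
    cancel = begin
      f 0 * - (f₀⁻¹ * s)    ≈⟨ -‿distribʳ-* _ _ ⟨
      - (f 0 * (f₀⁻¹ * s))  ≈⟨ -‿cong (*-assoc _ _ _) ⟨
      - (f 0 * f₀⁻¹ * s)    ≈⟨ -‿cong (*-congʳ f₀f₀⁻¹≈1) ⟩
      - (1# * s)            ≈⟨ -‿cong (*-identityˡ s) ⟩
      - s                   ∎
    same : ((f ∘ suc) *ˢ recip f inv) n ≈ s
    same = sum-cong-≋ {suc n} λ i →
      *-congˡ {f (suc (toℕ i))} (reflexive (≡.sym (lookup-recipPrefix f inv n i)))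

  -- Exponential generating functions and binomial convolution

  ×-*-interchange : ∀ m n x y → (m • x) * (n • y) ≈ (m ℕ.* n) • (x * y)
  ×-*-interchange m n x y = begin
    (m • x) * (n • y)     ≈⟨ ×-assoc-* m x (n • y) ⟩
    m • (x * (n • y))     ≈⟨ ×-congʳ m (×-comm-* n x y) ⟩
    m • (n • (x * y))     ≈⟨ ×-assocˡ (x * y) m n ⟩
    (m ℕ.* n) • (x * y)   ∎

  ×-distrib-sum : ∀ m {n} (f : Fin n → Carrier) → m • sum f ≈ sum (λ i → m • f i)
  ×-distrib-sum m {zero}  f = ×-zero m
    where
    ×-zero : ∀ m → m • 0# ≈ 0#
    ×-zero zero    = refl
    ×-zero (suc m) = trans (+-identityˡ _) (×-zero m)
  ×-distrib-sum m {suc n} f =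
    trans (×-distrib-+ (f zero) _ m) (+-congˡ (×-distrib-sum m (f ∘ suc)))

  egfCoefficients-*ˢ : ∀ f g n → egfCoefficients (f *ˢ g) n ≈
    sum {suc n} λ k → (n C toℕ k) •
      (egfCoefficients f (n ∸ toℕ k) * egfCoefficients g (toℕ k))
  egfCoefficients-*ˢ f g n = begin
    -- The factors are swapped so that the summation index `k` falls on `g` and `n ∸ k` on `f`.
    (n !) • (f *ˢ g) n                                   ≈⟨ ×-congʳ (n !) (*ˢ-comm f g n) ⟩
    (n !) • (g *ˢ f) n                                   ≈⟨ ×-distrib-sum (n !) {suc n} (λ k → g (toℕ k) * f (n ∸ toℕ k)) ⟩
    (sum {suc n} λ k → (n !) • (g (toℕ k) * f (n ∸ toℕ k))) ≈⟨ sum-cong-≋ {suc n} term ⟩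
    (sum {suc n} λ k → (n C toℕ k) •
      (egfCoefficients f (n ∸ toℕ k) * egfCoefficients g (toℕ k))) ∎
    where
    term : (i : Fin (suc n)) → let k = toℕ i in
      (n !) • (g k * f (n ∸ k)) ≈
      (n C k) • (egfCoefficients f (n ∸ k) * egfCoefficients g k)
    term i = begin
      (n !) • (g k * f (n ∸ k))
        ≡⟨ ≡.cong (_• (g k * f (n ∸ k))) (nCk*k![n∸k]!≡n! (toℕ≤pred[n] i)) ⟨
      ((n C k) ℕ.* (k ! ℕ.* (n ∸ k) !)) • (g k * f (n ∸ k))
        ≈⟨ ×-assocˡ _ (n C k) (k ! ℕ.* (n ∸ k) !) ⟨
      (n C k) • ((k ! ℕ.* (n ∸ k) !) • (g k * f (n ∸ k)))
        ≈⟨ ×-congʳ (n C k) (×-*-interchange (k !) ((n ∸ k) !) (g k) (f (n ∸ k))) ⟨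
      (n C k) • (egfCoefficients g k * egfCoefficients f (n ∸ k))
        ≈⟨ ×-congʳ (n C k) (*-comm _ _) ⟩
      (n C k) • (egfCoefficients f (n ∸ k) * egfCoefficients g k) ∎
      where
      k : ℕ
      k = toℕ i

-- Generalized falling factorials

module FallingFactorialProperties (R : CommutativeRing c ℓ) where
  open CommutativeRing R hiding (zero)
  open FallingFactorial R
  open Algebra.Definitions.RawSemiring (Semiring.rawSemiring semiring)
    using (_^_) renaming (_×_ to _•_)
  open Algebra.Properties.CommutativeSemigroup *-commutativeSemigroup
    using () renaming (interchange to *-interchange)
  open Algebra.Properties.Ring ring using (x[y-z]≈xy-xz)
  open Algebra.Properties.Semiring.Mult semiring using (×-congʳ; ×-comm-*)
  open Relation.Binary.Reasoning.Setoid setoid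

  fallingFactorial-cong : ∀ n {x x′ μ μ′} → x ≈ x′ → μ ≈ μ′ → ⟨ x ⟩[ n , μ ] ≈ ⟨ x′ ⟩[ n , μ′ ]
  fallingFactorial-cong zero    p q = refl
  fallingFactorial-cong (suc n) p q =
    *-cong (fallingFactorial-cong n p q) (+-cong p (-‿cong (×-congʳ n q)))

  -- Each of the `n` linear factors absorbs one copy of `a`, which scales the step `μ` along with
  -- `x`.
  fallingFactorial-homogeneous : ∀ n a x μ → a ^ n * ⟨ x ⟩[ n , μ ] ≈ ⟨ a * x ⟩[ n , a * μ ]
  fallingFactorial-homogeneous zero    a x μ = *-identityˡ 1#
  fallingFactorial-homogeneous (suc n) a x μ = begin
    (a * a ^ n) * (⟨ x ⟩[ n , μ ] * (x - n • μ))  ≈⟨ *-congʳ (*-comm _ _) ⟩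
    (a ^ n * a) * (⟨ x ⟩[ n , μ ] * (x - n • μ))  ≈⟨ *-interchange _ _ _ _ ⟩
    (a ^ n * ⟨ x ⟩[ n , μ ]) * (a * (x - n • μ))
      ≈⟨ *-cong (fallingFactorial-homogeneous n a x μ)
                (trans (x[y-z]≈xy-xz _ _ _) (+-congˡ (-‿cong (×-comm-* n a μ)))) ⟩
    ⟨ a * x ⟩[ suc n , a * μ ]                    ∎

-- The degenerate exponential and the Euler kernel

module DegenerateProperties (ℛ : RealNumbers c ℓ₁ ℓ₂ ℓ₃) (λ₀ : RealNumbers.ℝ ℛ)
                            (λ₀#0 : RealNumbers._#_ ℛ λ₀ (RealNumbers.0# ℛ)) where
  open RealNumbers ℛ using (ℝ; 0#; 1#; _•_)
  module ℝ = RealNumbers ℛ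
  open Complex ℛ
  open Units ℂ-commutativeRing
  open PowerSeries ℂ-commutativeRing
  open FallingFactorial ℂ-commutativeRing
  open PowerSeriesProperties ℂ-commutativeRing
  open FallingFactorialProperties ℂ-commutativeRing
  open Degenerate ℛ λ₀ λ₀#0
  open Algebra.Definitions.RawSemiring (Semiring.rawSemiring ℂ.semiring) using (_^_)
  open Algebra.Properties.CommutativeMonoid.Mult ℂ.+-commutativeMonoid using (×-distrib-+)
  open Algebra.Properties.Semiring.Mult ℂ.semiring
  open Algebra.Properties.Semiring.Sum ℂ.semiring using (sum-cong-≋)
  open Relation.Binary.Reasoning.Setoid ℂ.setoid

  /-cancelˡ : ∀ u z → value u ℂ.* z / u ℂ.≈ z
  /-cancelˡ u z = begin
    value u ℂ.* z ℂ.* inverse u    ≈⟨ ℂ.*-congʳ (ℂ.*-comm _ _) ⟩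
    z ℂ.* value u ℂ.* inverse u    ≈⟨ ℂ.*-assoc _ _ _ ⟩
    z ℂ.* (value u ℂ.* inverse u)  ≈⟨ ℂ.*-congˡ (proj₂ (proj₂ (invertible u))) ⟩
    z ℂ.* ℂ.1#                     ≈⟨ ℂ.*-identityʳ z ⟩
    z                              ∎

  *-/-cancel : ∀ u z → value u ℂ.* (z / u) ℂ.≈ z
  *-/-cancel u z = ℂ.trans (ℂ.sym (ℂ.*-assoc _ _ _)) (/-cancelˡ u z)

  •ℂ-1≈ofReal : ∀ n → n •ℂ ℂ.1# ℂ.≈ ofReal (n • 1#)
  •ℂ-1≈ofReal zero    = ℂ.refl
  •ℂ-1≈ofReal (suc n) =
    ℂ.trans (ℂ.+-congˡ (•ℂ-1≈ofReal n)) (ℝ.refl , ℝ.+-identityʳ 0#)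

  -- Relates two forms of a natural number: the repeated addition in `egfCoefficients` and the
  -- invertible complex number by which `binomialSeries` divides.
  •ℂ≈natUnit-* : ∀ n .{{_ : NonZero n}} z → n •ℂ z ℂ.≈ value (natUnit n) ℂ.* z
  •ℂ≈natUnit-* n@(suc _) z = begin
    n •ℂ z                        ≈⟨ ×-congʳ n (ℂ.*-identityˡ z) ⟨
    n •ℂ (ℂ.1# ℂ.* z)             ≈⟨ ×-assoc-* n ℂ.1# z ⟨
    (n •ℂ ℂ.1#) ℂ.* z             ≈⟨ ℂ.*-congʳ (•ℂ-1≈ofReal n) ⟩
    value (natUnit n) ℂ.* z       ∎

  egfCoefficients-e : ∀ n → egfCoefficients e n ℂ.≈ ⟨ ℂ.1# ⟩[ n , ofReal λ₀ ]
  egfCoefficients-e n = begin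
    (n !) •ℂ (λ^n ℂ.* (φ / n!ᵘ))             ≈⟨ •ℂ≈natUnit-* (n !) _ ⟩
    value n!ᵘ ℂ.* (λ^n ℂ.* (φ / n!ᵘ))        ≈⟨ ℂ.*-congˡ (ℂ.*-assoc _ _ _) ⟨
    value n!ᵘ ℂ.* (λ^n ℂ.* φ / n!ᵘ)          ≈⟨ *-/-cancel n!ᵘ _ ⟩
    λ^n ℂ.* φ                                ≈⟨ fallingFactorial-homogeneous n _ _ _ ⟩
    ⟨ value λᵘ ℂ.* (ℂ.1# / λᵘ) ⟩[ n , value λᵘ ℂ.* ℂ.1# ]
      -- Since `value λᵘ` is `ofReal λ₀` by definition, the argument `1 / λ` is scaled to 1 and the
      -- step 1 to `ofReal λ₀`.
      ≈⟨ fallingFactorial-cong n (*-/-cancel λᵘ ℂ.1#) (ℂ.*-identityʳ _) ⟩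
    ⟨ ℂ.1# ⟩[ n , ofReal λ₀ ]                ∎
    where
    instance
      n!≢0 : NonZero (n !)
      n!≢0 = n !≢0
    n!ᵘ : Unit
    n!ᵘ = natUnit (n !)
    λ^n φ : ℂ
    λ^n = ofReal λ₀ ^ n
    φ = ⟨ ℂ.1# / λᵘ ⟩[ n , ℂ.1# ]

  -- Regrouping brings `e+1` next to its reciprocal inside the kernel; the two cancel and leave the
  -- factor 2.
  e+1-*ˢ-eulerKernel : ∀ f g → e+1 *ˢ (eulerKernel *ˢ f *ˢ g) ≈ˢ constant (value 2ᵘ) *ˢ (f *ˢ g)
  e+1-*ˢ-eulerKernel f g = S.begin
    e+1 *ˢ (2ˢ *ˢ r *ˢ f *ˢ g)
      S.≈⟨ *ˢ-congˡ e+1 (λ n → ℂ.trans (*ˢ-assoc (2ˢ *ˢ r) f g n) (*ˢ-assoc 2ˢ r (f *ˢ g) n)) ⟩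
    e+1 *ˢ (2ˢ *ˢ (r *ˢ (f *ˢ g)))   S.≈⟨ x∙yz≈y∙xz e+1 2ˢ (r *ˢ (f *ˢ g)) ⟩
    2ˢ *ˢ (e+1 *ˢ (r *ˢ (f *ˢ g)))   S.≈⟨ *ˢ-congˡ 2ˢ cancel ⟩
    2ˢ *ˢ (f *ˢ g)                   S.∎
    where
    module S = Relation.Binary.Reasoning.Setoid
      (CommutativeSemigroup.setoid *ˢ-commutativeSemigroup)
    open Algebra.Properties.CommutativeSemigroup *ˢ-commutativeSemigroup using (x∙yz≈y∙xz)
    2ˢ r : Series
    2ˢ = constant (value 2ᵘ)
    r = recip e+1 e+1-invertible
    *ˢ-congˡ : ∀ h {f g} → f ≈ˢ g → h *ˢ f ≈ˢ h *ˢ g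
    *ˢ-congˡ h p = *ˢ-cong {h} (λ _ → ℂ.refl) p
    cancel : e+1 *ˢ (r *ˢ (f *ˢ g)) ≈ˢ f *ˢ g
    cancel n = begin
      (e+1 *ˢ (r *ˢ (f *ˢ g))) n        ≈⟨ *ˢ-assoc e+1 r (f *ˢ g) n ⟨
      (e+1 *ˢ r *ˢ (f *ˢ g)) n
        ≈⟨ *ˢ-cong {g = f *ˢ g} (*ˢ-recip e+1 e+1-invertible) (λ _ → ℂ.refl) n ⟩
      (constant ℂ.1# *ˢ (f *ˢ g)) n     ≈⟨ constant-*ˢ ℂ.1# (f *ˢ g) n ⟩
      ℂ.1# ℂ.* (f *ˢ g) n               ≈⟨ ℂ.*-identityˡ _ ⟩
      (f *ˢ g) n                        ∎

  -- Stated for arbitrary `f` and `g`, so that the cosine and sine identities are both instances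
  -- with `f` the series `eᵖ (ofReal x)`.
  egfCoefficients-via-eulerKernel : ∀ f g n →
    let a = egfCoefficients (eulerKernel *ˢ f *ˢ g) in
    egfCoefficients (f *ˢ g) n ℂ.≈
      (∑ {suc n} (λ l → (n C toℕ l) •ℂ (⟨ ℂ.1# ⟩[ n ∸ toℕ l , ofReal λ₀ ] ℂ.* a (toℕ l)))
        ℂ.+ a n) / 2ᵘ
  egfCoefficients-via-eulerKernel f g n = ℂ.sym (begin
    (∑ {suc n} (λ l → (n C toℕ l) •ℂ (⟨ ℂ.1# ⟩[ n ∸ toℕ l , ofReal λ₀ ] ℂ.* a (toℕ l)))
      ℂ.+ a n) / 2ᵘ
      ≈⟨ ℂ.*-congʳ (ℂ.+-congʳ (sum-cong-≋ {suc n} λ l →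
           ×-congʳ (n C toℕ l) (ℂ.*-congʳ {a (toℕ l)} (egfCoefficients-e (n ∸ toℕ l))))) ⟨
    (∑ {suc n} (λ l → (n C toℕ l) •ℂ (egfCoefficients e (n ∸ toℕ l) ℂ.* a (toℕ l)))
      ℂ.+ a n) / 2ᵘ
      ≈⟨ ℂ.*-congʳ (ℂ.+-congʳ (egfCoefficients-*ˢ e F n)) ⟨
    (egfCoefficients (e *ˢ F) n ℂ.+ a n) / 2ᵘ         ≈⟨ ℂ.*-congʳ (×-distrib-+ _ _ (n !)) ⟨
    (n !) •ℂ ((e *ˢ F) n ℂ.+ F n) / 2ᵘ
      -- The lone summand `F n` is written as a product with the constant series 1, so that
      -- distributivity can collect both terms into `e+1 *ˢ F`.
      ≈⟨ ℂ.*-congʳ (×-congʳ (n !) (ℂ.+-congˡ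
           (ℂ.trans (constant-*ˢ ℂ.1# F n) (ℂ.*-identityˡ _)))) ⟨
    (n !) •ℂ ((e *ˢ F) n ℂ.+ (constant ℂ.1# *ˢ F) n) / 2ᵘ
      ≈⟨ ℂ.*-congʳ (×-congʳ (n !) (*ˢ-distribʳ e (constant ℂ.1#) F n)) ⟨
    (n !) •ℂ (e+1 *ˢ F) n / 2ᵘ
      ≈⟨ ℂ.*-congʳ (×-congʳ (n !) (e+1-*ˢ-eulerKernel f g n)) ⟩
    (n !) •ℂ (constant (value 2ᵘ) *ˢ (f *ˢ g)) n / 2ᵘ
      ≈⟨ ℂ.*-congʳ (×-congʳ (n !) (constant-*ˢ (value 2ᵘ) (f *ˢ g) n)) ⟩
    (n !) •ℂ (value 2ᵘ ℂ.* (f *ˢ g) n) / 2ᵘ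
      -- The factor 2 is moved outside the multiple by `n !`, where the final division cancels it.
      ≈⟨ ℂ.*-congʳ (×-comm-* (n !) (value 2ᵘ) _) ⟨
    value 2ᵘ ℂ.* ((n !) •ℂ (f *ˢ g) n) / 2ᵘ           ≈⟨ /-cancelˡ 2ᵘ _ ⟩
    (n !) •ℂ (f *ˢ g) n                               ∎)
    where
    F : Series
    F = eulerKernel *ˢ f *ˢ g
    a : ℕ → ℂ
    a = egfCoefficients F

theorem2p4 :
  ∀ {c ℓ₁ ℓ₂ ℓ₃} (ℛ : RealNumbers c ℓ₁ ℓ₂ ℓ₃) →
  let open RealNumbers ℛ
      open Complex ℛ
      open Units ℂ-commutativeRing
      open FallingFactorial ℂ-commutativeRing
  in
  (λ₀ : ℝ) (λ₀#0 : λ₀ # 0#) (x y : ℝ) (n : ℕ) →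
  let open Degenerate ℛ λ₀ λ₀#0
  in
  (𝒞 n x y ℂ.≈
    (∑ {suc n} (λ l → (n C toℕ l) •ℂ (⟨ ℂ.1# ⟩[ n ∸ toℕ l , ofReal λ₀ ] ℂ.* 𝓔ᶜ (toℕ l) x y))
      ℂ.+ 𝓔ᶜ n x y) / 2ᵘ)
  ×
  (𝒮 n x y ℂ.≈
    (∑ {suc n} (λ l → (n C toℕ l) •ℂ (⟨ ℂ.1# ⟩[ n ∸ toℕ l , ofReal λ₀ ] ℂ.* 𝓔ˢ (toℕ l) x y))
      ℂ.+ 𝓔ˢ n x y) / 2ᵘ)
theorem2p4 ℛ λ₀ λ₀#0 x y n =
  egfCoefficients-via-eulerKernel (eᵖ (ofReal x)) (cosˢ y) n ,
  egfCoefficients-via-eulerKernel (eᵖ (ofReal x)) (sinˢ y) n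
  where
  open Complex ℛ using (ofReal)
  open Degenerate ℛ λ₀ λ₀#0 using (eᵖ; cosˢ; sinˢ)
  open DegenerateProperties ℛ λ₀ λ₀#0 using (egfCoefficients-via-eulerKernel)
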